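{- For $n \geq 4$, a connected graph $G$ of order $n$ satisfies $\mathrm{vp}^-(G) = \mathrm{vp}(G) = n-2$ if and only if $G$ is isomorphic to a clique of even order with a perfect matching deleted, i.e. if and only if $G \cong K_{2,2,\dots,2}$.
   Context: All graphs are finite, undirected and simple. $K_{2,2,\dots,2}$ denotes a complete multipartite graph all of whose partite sets have size two. A $u,v$-geodesic is a shortest $u,v$-path. For a vertex $x$ of $G$, a set $S \subseteq V(G)$ is an $x$-position set if for every $y \in S$ no vertex of $S \setminus \{y\}$ lies on any $x,y$-geodesic in $G$. The $x$-position number $p_x(G)$ is the maximum cardinality of an $x$-position set of $G$. Define $\mathrm{vp}(G) = \max_{x \in V(G)} p_x(G)$ and $\mathrm{vp}^-(G) = \min_{x \in V(G)} p_x(G)$. -}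

module Defs where

open import Data.Fin using (Fin; zero; suc; _≟_)
open import Data.Fin.Properties using (any?; all?; injective⇒≤)
open import Data.Fin.Subset using (Subset; inside; outside; ∣_∣; _∈_)
open import Data.Fin.Subset.Properties using (_∈?_)
open import Data.List using (List; _∷_; [_]; _++_; map; filter; allFin; lookup)
import Data.List as List
open import Data.List.Extrema.Nat using (max; min)
open import Data.List.Membership.Propositional using () renaming (_∈_ to _∈ˡ_)
import Data.List.Membership.DecPropositional as DecMembership
import Data.List.Relation.Unary.All as All
open import Data.List.Membership.Propositional.Properties using (∈-lookup)
import Data.List.Relation.Unary.AllPairs as AllPairs
open import Data.List.Relation.Unary.Unique.Propositional using (Unique)
import Data.List.Relation.Unary.Unique.DecPropositional as DecUnique
open import Data.Nat using (ℕ; zero; suc; _≤_; _<_)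
import Data.Nat.Properties as ℕ
open import Data.Nat.Divisibility using (_∣_)
open import Data.Product using (Σ; ∃; ∃!; ∃-syntax; _×_; _,_)
open import Data.Vec using ([]; _∷_)
open import Function using (_∘_)
open import Function.Bundles using (_↔_; _⇔_; Inverse)
open import Level using (0ℓ)
open import Relation.Binary using (Rel; Symmetric; Irreflexive) renaming (Decidable to Decidable₂)
open import Relation.Binary.PropositionalEquality
  using (_≡_; _≢_; refl; sym; cong; subst; ≢-sym)
open import Relation.Nullary using (¬_; Dec; contradiction)
open import Relation.Nullary.Decidable using (map′; ¬?; _×-dec_; _→-dec_)
open import Relation.Unary using (Pred; Decidable)

record SimpleGraph (V : Set) : Set₁ where
  field
    Adj      : Rel V 0ℓ
    adj?     : Decidable₂ Adj
    adj-sym  : Symmetric Adj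
    adj-irr  : Irreflexive _≡_ Adj

open SimpleGraph public

infix 4 _≅_

record _≅_ {V W : Set} (G : SimpleGraph V) (H : SimpleGraph W) : Set where
  field
    vertices↔ : V ↔ W
    adj⇔      : ∀ u v → Adj G u v ⇔ Adj H (Inverse.to vertices↔ u) (Inverse.to vertices↔ v)

module _ {V : Set} (G : SimpleGraph V) where

  data Walk : V → V → Set where
    nil  : ∀ {u} → Walk u u
    cons : ∀ {u v w} → Adj G u v → Walk v w → Walk u w

module _ {V : Set} {G : SimpleGraph V} where

  length : ∀ {u v} → Walk G u v → ℕ
  length nil        = 0
  length (cons _ p) = suc (length p)

  vertices : ∀ {u v} → Walk G u v → List V
  vertices {u} nil        = [ u ]
  vertices {u} (cons _ p) = u ∷ vertices p

  IsPath : ∀ {u v} → Walk G u v → Set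
  IsPath p = Unique (vertices p)

  IsGeodesic : ∀ {u v} → Walk G u v → Set
  IsGeodesic {u} {v} p = IsPath p × (∀ (q : Walk G u v) → IsPath q → length p ≤ length q)

module _ {V : Set} (G : SimpleGraph V) where

  Connected : Set
  Connected = ∀ u v → ∃[ p ] IsPath {G = G} {u} {v} p

  OnGeodesic : V → V → V → Set
  OnGeodesic x y z = Σ (Walk G x y) λ p → IsGeodesic p × z ∈ˡ vertices p

IsPositionSet : ∀ {n} → SimpleGraph (Fin n) → Fin n → Subset n → Set
IsPositionSet G x S = ∀ y → y ∈ S → ∀ z → z ∈ S → z ≢ y → ¬ OnGeodesic G x y z

private

  lookup-injective : ∀ {A : Set} {xs : List A} → Unique xs →
                     ∀ {i j} → lookup xs i ≡ lookup xs j → i ≡ j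
  lookup-injective (_ AllPairs.∷ _)  {zero}  {zero}  _  = refl
  lookup-injective {xs = _ ∷ xs} (x∉ AllPairs.∷ _) {zero}  {suc j} eq =
    contradiction eq (All.lookup x∉ (∈-lookup {xs = xs} j))
  lookup-injective {xs = _ ∷ xs} (x∉ AllPairs.∷ _) {suc i} {zero}  eq =
    contradiction (sym eq) (All.lookup x∉ (∈-lookup {xs = xs} i))
  lookup-injective (_ AllPairs.∷ u)  {suc i} {suc j} eq = cong suc (lookup-injective u eq)

  unique-length : ∀ {n} {xs : List (Fin n)} → Unique xs → List.length xs ≤ n
  unique-length u = injective⇒≤ (lookup-injective u)

module _ {n} (G : SimpleGraph (Fin n)) where

  private
    length-vertices : ∀ {u v} (p : Walk G u v) → List.length (vertices p) ≡ suc (length p)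
    length-vertices nil        = refl
    length-vertices (cons _ p) = cong suc (length-vertices p)

    path-length : ∀ {u v} (p : Walk G u v) → IsPath p → length p < n
    path-length p u = subst (_≤ n) (length-vertices p) (unique-length u)

    WalkOfLength : ℕ → Pred (List (Fin n)) 0ℓ → Fin n → Fin n → Set
    WalkOfLength k P u v = Σ (Walk G u v) λ p → length p ≡ k × P (vertices p)

    walkOfLength? : ∀ k {P} → Decidable P → ∀ u v → Dec (WalkOfLength k P u v)
    walkOfLength? zero {P} P? u v = map′ to from (u ≟ v ×-dec P? [ u ])
      where
      to : u ≡ v × P [ u ] → WalkOfLength zero P u v
      to (refl , Pu) = nil , refl , Pu
      from : WalkOfLength zero P u v → u ≡ v × P [ u ]
      from (nil , _ , Pu) = refl , Pu
    walkOfLength? (suc k) {P} P? u v =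
      map′ to from (any? λ w → adj? G u w ×-dec walkOfLength? k (P? ∘ (u ∷_)) w v)
      where
      Step : Set
      Step = ∃ λ w → Adj G u w × WalkOfLength k (P ∘ (u ∷_)) w v
      to : Step → WalkOfLength (suc k) P u v
      to (_ , e , p , eq , Pp) = cons e p , cong suc eq , Pp
      from : WalkOfLength (suc k) P u v → Step
      from (cons e p , eq , Pp) = _ , e , p , ℕ.suc-injective eq , Pp

  onGeodesic? : ∀ x y z → Dec (OnGeodesic G x y z)
  onGeodesic? x y z = map′ to from
    (ℕ.anyUpTo? (λ k →
      walkOfLength? k (λ vs → DecUnique.unique? _≟_ vs ×-dec DecMembership._∈?_ _≟_ z vs) x y
      ×-dec ℕ.allUpTo? (λ j → ¬? (walkOfLength? j (DecUnique.unique? _≟_) x y)) k) n)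
    where
    Bounded : Set
    Bounded = ∃ λ k → k < n
      × WalkOfLength k (λ vs → Unique vs × z ∈ˡ vs) x y
      × (∀ {j} → j < k → ¬ WalkOfLength j Unique x y)
    to : Bounded → OnGeodesic G x y z
    to (_ , _ , (p , refl , u , z∈p) , least) =
      p , (u , λ q uq → ℕ.≮⇒≥ λ q<p → least q<p (q , refl , uq)) , z∈p
    from : OnGeodesic G x y z → Bounded
    from (p , (u , least) , z∈p) =
      length p , path-length p u , (p , refl , u , z∈p) ,
      λ { j<p (q , refl , uq) → ℕ.<⇒≱ j<p (least q uq) }

  isPositionSet? : ∀ x → Decidable (IsPositionSet G x)
  isPositionSet? x S =
    all? λ y → y ∈? S →-dec
    all? λ z → z ∈? S →-dec
    ¬? (z ≟ y) →-dec
    ¬? (onGeodesic? x y z)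

allSubsets : ∀ n → List (Subset n)
allSubsets zero    = [ [] ]
allSubsets (suc n) = map (inside ∷_) (allSubsets n) ++ map (outside ∷_) (allSubsets n)

-- The default 0 is attained by the empty set, which is a position set.
positionNumber : ∀ {n} → SimpleGraph (Fin n) → Fin n → ℕ
positionNumber {n} G x = max 0 (map ∣_∣ (filter (isPositionSet? G x) (allSubsets n)))

-- Since 0 ≤ positionNumber G x ≤ n for every x, the defaults 0 and n below do not affect
-- the maximum and the minimum as soon as there is a vertex.
vp : ∀ {n} → SimpleGraph (Fin n) → ℕ
vp {n} G = max 0 (map (positionNumber G) (allFin n))

vp⁻ : ∀ {n} → SimpleGraph (Fin n) → ℕ
vp⁻ {n} G = min n (map (positionNumber G) (allFin n))

complete : ∀ m → SimpleGraph (Fin m)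
complete m = record
  { Adj     = _≢_
  ; adj?    = λ u v → ¬? (u ≟ v)
  ; adj-sym = ≢-sym
  ; adj-irr = λ u≡v u≢v → u≢v u≡v
  }

module _ {V : Set} where

  infixl 6 _∖_

  _∖_ : SimpleGraph V → SimpleGraph V → SimpleGraph V
  G ∖ M = record
    { Adj     = λ u v → Adj G u v × ¬ Adj M u v
    ; adj?    = λ u v → adj? G u v ×-dec ¬? (adj? M u v)
    ; adj-sym = λ (g , ¬m) → adj-sym G g , ¬m ∘ adj-sym M
    ; adj-irr = λ u≡v (g , _) → adj-irr G u≡v g
    }

  -- A set of edges is encoded as the spanning graph having exactly these edges.
  IsPerfectMatching : SimpleGraph V → SimpleGraph V → Set
  IsPerfectMatching G M =
    (∀ {u v} → Adj M u v → Adj G u v) × (∀ u → ∃! _≡_ (Adj M u))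

IsEvenCliqueMinusPerfectMatching : ∀ {V} → SimpleGraph V → Set₁
IsEvenCliqueMinusPerfectMatching G =
  Σ ℕ λ m → Σ (SimpleGraph (Fin m)) λ M →
    2 ∣ m × IsPerfectMatching (complete m) M × G ≅ complete m ∖ M

completeMultipartite : ∀ {k} (size : Fin k → ℕ) → SimpleGraph (Σ (Fin k) (Fin ∘ size))
completeMultipartite size = record
  { Adj     = λ (i , _) (j , _) → i ≢ j
  ; adj?    = λ (i , _) (j , _) → ¬? (i ≟ j)
  ; adj-sym = ≢-sym
  ; adj-irr = λ { refl i≢i → i≢i refl }
  }

K₂,…,₂ : ∀ k → SimpleGraph (Fin k × Fin 2)
K₂,…,₂ k = completeMultipartite {k} λ _ → 2

{-# OPTIONS --safe #-}

-- Write ω for the vertex that, besides x, is omitted by an x-position set of size n − 2. Every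
-- geodesic from x then has at most one vertex other than x and ω, so the diameter is at most two
-- and each non-neighbour y of x either equals ω or is joined to x through ω only. The second case
-- is impossible: ω has a non-neighbour u, and looking for a common neighbour of u and y gives a
-- contradiction. As x is not universal (otherwise p_x = n − 1), it has exactly one non-neighbour.
-- Conversely, if w is the only non-neighbour of x, then V ∖ {x , w} is an x-position set, while a
-- larger set contains x and a neighbour of x, or w and a common neighbour of x and w.

module Submission where

open import Defs
open import Data.Empty using (⊥; ⊥-elim)
open import Data.Fin using (Fin; zero; suc; opposite; _≟_) renaming (_<_ to _<ᶠ_; _<?_ to _<ᶠ?_)
open import Data.Fin.Permutation using (↔⇒≡)
import Data.Fin.Properties as Fin
open import Data.Fin.Subset as Subset
  using (Subset; inside; outside; ∣_∣; _∈_; _∉_; _-_; ⊤; ⁅_⁆)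
open import Data.Fin.Subset.Properties
open import Data.List as List using (List; []; _∷_; map; filter; allFin; lookup)
open import Data.List.Extrema.Nat using (argmax-sel; xs≤max; min≤xs; max≤v⁺; v≤min⁺)
open import Data.List.Membership.Propositional using () renaming (_∈_ to _∈ˡ_)
open import Data.List.Membership.Propositional.Properties
  using (∈-map⁺; ∈-map⁻; ∈-++⁺ˡ; ∈-++⁺ʳ; ∈-filter⁺; ∈-filter⁻; ∈-allFin; ∈-lookup)
open import Data.List.Relation.Unary.All as All using ([]; _∷_)
import Data.List.Relation.Unary.All.Properties as All
open import Data.List.Relation.Unary.AllPairs using ([]; _∷_)
open import Data.List.Relation.Unary.Any using (here; there)
open import Data.List.Relation.Unary.Any.Properties using (lookup-index)
open import Data.List.Relation.Unary.Unique.Propositional using (Unique)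
import Data.List.Relation.Unary.Unique.Propositional.Properties as Unique
open import Data.Nat using (ℕ; zero; suc; _+_; _≤_; _<_; _≥_; _∸_; z≤n; s≤s; s≤s⁻¹)
open import Data.Nat.Divisibility using (divides)
open import Data.Nat.Induction using (<-rec)
import Data.Nat.Properties as ℕ
open import Data.Product using (∃; ∃!; ∃₂; ∃-syntax; _×_; _,_; proj₁; proj₂)
open import Data.Sum using (_⊎_; inj₁; inj₂)
open import Data.Vec using ([]; _∷_; there)
open import Function using (_∘_; id)
open import Function.Bundles using (_⇔_; _↔_; Inverse; Equivalence; mk⇔; mk⤖)
open import Function.Construct.Composition using (_↔-∘_)
import Function.Construct.Identity as Identity
import Function.Construct.Symmetry as Symmetry
open import Function.Properties.Bijection using (⤖⇒↔)
open import Relation.Binary using (tri<; tri≈; tri>)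
open import Relation.Binary.PropositionalEquality
  using (_≡_; _≢_; refl; sym; trans; cong; subst; subst₂; ≢-sym)
open import Relation.Nullary using (¬_; Dec; yes; no; contradiction)
open import Relation.Nullary.Decidable using (¬?; _×-dec_; _⊎-dec_; decidable-stable)

-- Cardinalities of subsets

x∉p-x : ∀ {n} (p : Subset n) x → x ∉ p - x
x∉p-x (inside  ∷ p) zero ()
x∉p-x (outside ∷ p) zero ()
x∉p-x (_ ∷ p) (suc x) (there x∈) = x∉p-x p x x∈

x∈p-y⇒x≢y : ∀ {n} {p : Subset n} {x y} → x ∈ p - y → x ≢ y
x∈p-y⇒x≢y x∈ refl = x∉p-x _ _ x∈

∣p∣≤1+∣p-x∣ : ∀ {n} (p : Subset n) x → ∣ p ∣ ≤ suc ∣ p - x ∣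
∣p∣≤1+∣p-x∣ (inside  ∷ p) zero    = s≤s (ℕ.≤-reflexive (cong ∣_∣ (sym (p─⊥≡p p))))
∣p∣≤1+∣p-x∣ (outside ∷ p) zero    = ℕ.m≤n⇒m≤1+n (ℕ.≤-reflexive (cong ∣_∣ (sym (p─⊥≡p p))))
∣p∣≤1+∣p-x∣ (inside  ∷ p) (suc x) = s≤s (∣p∣≤1+∣p-x∣ p x)
∣p∣≤1+∣p-x∣ (outside ∷ p) (suc x) = ∣p∣≤1+∣p-x∣ p x

x∉p⇒p⊆q-x : ∀ {n} {p q : Subset n} {x} → x ∉ p → p Subset.⊆ q → p Subset.⊆ q - x
x∉p⇒p⊆q-x x∉p p⊆q y∈p =
  x∈p∧x≢y⇒x∈p-y (p⊆q y∈p) λ { refl → x∉p y∈p }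

-- Vertices are later produced from cardinalities alone; the finite search makes this counting
-- constructive.
∣p∣<∣q∣⇒∃∈q∉p : ∀ {n} {p q : Subset n} → ∣ p ∣ < ∣ q ∣ → ∃ λ x → x ∈ q × x ∉ p
∣p∣<∣q∣⇒∃∈q∉p {p = p} {q} p<q with Fin.any? (λ x → x ∈? q ×-dec ¬? (x ∈? p))
... | yes found = found
... | no none = contradiction
  (p⊆q⇒∣p∣≤∣q∣ λ {x} x∈q → decidable-stable (x ∈? p) λ x∉p → none (x , x∈q , x∉p))
  (ℕ.<⇒≱ p<q)

module _ {n : ℕ} where

  n≤1+∣⊤-x∣ : ∀ (x : Fin n) → n ≤ suc ∣ ⊤ - x ∣
  n≤1+∣⊤-x∣ x = subst (_≤ suc ∣ ⊤ - x ∣) (∣⊤∣≡n n) (∣p∣≤1+∣p-x∣ ⊤ x)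

  n≤2+∣⊤-x-y∣ : ∀ (x y : Fin n) → n ≤ 2 + ∣ ⊤ - x - y ∣
  n≤2+∣⊤-x-y∣ x y = ℕ.≤-trans (n≤1+∣⊤-x∣ x) (s≤s (∣p∣≤1+∣p-x∣ (⊤ - x) y))

  n≤3+∣⊤-x-y-z∣ : ∀ (x y z : Fin n) → n ≤ 3 + ∣ ⊤ - x - y - z ∣
  n≤3+∣⊤-x-y-z∣ x y z = ℕ.≤-trans (n≤2+∣⊤-x-y∣ x y) (s≤s (s≤s (∣p∣≤1+∣p-x∣ (⊤ - x - y) z)))

  1+∣⊤-x∣≤n : ∀ (x : Fin n) → suc ∣ ⊤ - x ∣ ≤ n
  1+∣⊤-x∣≤n x = subst (suc ∣ ⊤ - x ∣ ≤_) (∣⊤∣≡n n) (x∈p⇒∣p-x∣<∣p∣ {x = x} {⊤} ∈⊤)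

  2+∣⊤-x-y∣≤n : ∀ {x y : Fin n} → y ≢ x → 2 + ∣ ⊤ - x - y ∣ ≤ n
  2+∣⊤-x-y∣≤n {x} y≢x =
    ℕ.≤-trans (s≤s (x∈p⇒∣p-x∣<∣p∣ (x∈p∧x≢y⇒x∈p-y ∈⊤ y≢x))) (1+∣⊤-x∣≤n x)

  2+∣p∣≤n : ∀ {p : Subset n} {x y} → x ∉ p → y ∉ p → y ≢ x → 2 + ∣ p ∣ ≤ n
  2+∣p∣≤n x∉p y∉p y≢x = ℕ.≤-trans
    (s≤s (s≤s (p⊆q⇒∣p∣≤∣q∣ (x∉p⇒p⊆q-x y∉p (x∉p⇒p⊆q-x x∉p λ _ → ∈⊤)))))
    (2+∣⊤-x-y∣≤n y≢x)

  3+∣p∣≤n : ∀ {p : Subset n} {x y z} → x ∉ p → y ∉ p → z ∉ p →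
            y ≢ x → z ≢ x → z ≢ y → 3 + ∣ p ∣ ≤ n
  3+∣p∣≤n x∉p y∉p z∉p y≢x z≢x z≢y = ℕ.≤-trans
    (s≤s (s≤s (ℕ.≤-trans
      (s≤s (p⊆q⇒∣p∣≤∣q∣ (x∉p⇒p⊆q-x z∉p (x∉p⇒p⊆q-x y∉p (x∉p⇒p⊆q-x x∉p λ _ → ∈⊤)))))
      (x∈p⇒∣p-x∣<∣p∣ (x∈p∧x≢y⇒x∈p-y (x∈p∧x≢y⇒x∈p-y ∈⊤ z≢x) z≢y)))))
    (2+∣⊤-x-y∣≤n y≢x)

-- Position numbers

∈-allSubsets : ∀ {n} (S : Subset n) → S ∈ˡ allSubsets n
∈-allSubsets []            = here refl
∈-allSubsets (inside  ∷ S) = ∈-++⁺ˡ (∈-map⁺ (inside ∷_) (∈-allSubsets S))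
∈-allSubsets (outside ∷ S) = ∈-++⁺ʳ _ (∈-map⁺ (outside ∷_) (∈-allSubsets S))

module _ {n} (G : SimpleGraph (Fin n)) where

  ∣S∣≤positionNumber : ∀ {x S} → IsPositionSet G x S → ∣ S ∣ ≤ positionNumber G x
  ∣S∣≤positionNumber {x} {S} pos = All.lookup (xs≤max 0 _)
    (∈-map⁺ ∣_∣ (∈-filter⁺ (isPositionSet? G x) (∈-allSubsets S) pos))

  positionNumber-attained : ∀ x → ∃ λ S → IsPositionSet G x S × positionNumber G x ≡ ∣ S ∣
  positionNumber-attained x
    with argmax-sel id 0 (map ∣_∣ (filter (isPositionSet? G x) (allSubsets n)))
  -- The default 0 of the maximum is realised by the empty position set.
  ... | inj₁ ≡0 = Subset.⊥ , (λ _ y∈⊥ → contradiction y∈⊥ ∉⊥) , trans ≡0 (sym (∣⊥∣≡0 n))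
  ... | inj₂ ∈sizes with ∈-map⁻ ∣_∣ ∈sizes
  ... | S , S∈ , eq = S , proj₂ (∈-filter⁻ (isPositionSet? G x) {xs = allSubsets n} S∈) , eq

  -- The vertex `x₀` bounds both extrema by an actual value, and `k ≤ n` keeps the default `n` of
  -- the minimum from undercutting `k`.
  positionNumber-const⇔vp : ∀ {k} → Fin n → k ≤ n →
    (∀ x → positionNumber G x ≡ k) ⇔ (vp⁻ G ≡ k × vp G ≡ k)
  positionNumber-const⇔vp {k} x₀ k≤n = mk⇔ to from
    where
    vp⁻≤ : ∀ x → vp⁻ G ≤ positionNumber G x
    vp⁻≤ x = All.lookup (min≤xs n _) (∈-map⁺ (positionNumber G) (∈-allFin x))
    ≤vp : ∀ x → positionNumber G x ≤ vp G
    ≤vp x = All.lookup (xs≤max 0 _) (∈-map⁺ (positionNumber G) (∈-allFin x))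
    to : (∀ x → positionNumber G x ≡ k) → vp⁻ G ≡ k × vp G ≡ k
    to const =
      ℕ.≤-antisym
        (subst (vp⁻ G ≤_) (const x₀) (vp⁻≤ x₀))
        (v≤min⁺ {xs = map (positionNumber G) (allFin n)} k≤n
          (All.map⁺ (All.tabulate λ {x} _ → ℕ.≤-reflexive (sym (const x))))) ,
      ℕ.≤-antisym
        (max≤v⁺ {xs = map (positionNumber G) (allFin n)} z≤n
          (All.map⁺ (All.tabulate λ {x} _ → ℕ.≤-reflexive (const x))))
        (subst (_≤ vp G) (const x₀) (≤vp x₀))
    from : vp⁻ G ≡ k × vp G ≡ k → ∀ x → positionNumber G x ≡ k
    from (vp⁻≡k , vp≡k) x =
      ℕ.≤-antisym (subst (_ ≤_) vp≡k (≤vp x)) (subst (_≤ _) vp⁻≡k (vp⁻≤ x))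

-- Geodesics

module _ {V : Set} (G : SimpleGraph V) where

  adj⇒≢ : ∀ {u v} → Adj G u v → u ≢ v
  adj⇒≢ uv u≡v = adj-irr G u≡v uv

  path₁ : ∀ {x y} (xy : Adj G x y) → IsPath {G = G} (cons xy nil)
  path₁ xy = (adj⇒≢ xy ∷ []) ∷ [] ∷ []

  -- The edge itself is a path of length one, so a geodesic has no inner vertex.
  adj⇒geodesic-ends : ∀ {x y z} → Adj G x y → OnGeodesic G x y z → z ≡ x ⊎ z ≡ y
  adj⇒geodesic-ends xy (nil , _ , here z≡x) = inj₁ z≡x
  adj⇒geodesic-ends xy (cons _ nil , _ , here z≡x) = inj₁ z≡x
  adj⇒geodesic-ends xy (cons _ nil , _ , there (here z≡y)) = inj₂ z≡y
  adj⇒geodesic-ends xy (cons _ (cons _ _) , (_ , least) , _) with least (cons xy nil) (path₁ xy)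
  ... | s≤s ()

  adj⇒start-onGeodesic : ∀ {x y} → Adj G x y → OnGeodesic G x y x
  adj⇒start-onGeodesic {x} {y} xy = cons xy nil , (path₁ xy , least) , here refl
    where
    least : (q : Walk G x y) → IsPath q → 1 ≤ length q
    least nil        _ = contradiction xy (adj-irr G refl)
    least (cons _ _) _ = s≤s z≤n

  commonNeighbour⇒onGeodesic : ∀ {x y a} → y ≢ x → ¬ Adj G x y → Adj G x a → Adj G a y →
                               OnGeodesic G x y a
  commonNeighbour⇒onGeodesic {x} {y} y≢x ¬xy xa ay =
    cons xa (cons ay nil) ,
    (((adj⇒≢ xa ∷ ≢-sym y≢x ∷ []) ∷ path₁ ay) , least) ,
    there (here refl)
    where
    least : (q : Walk G x y) → IsPath q → 2 ≤ length q
    least nil                 _ = contradiction refl y≢x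
    least (cons xy nil)       _ = contradiction xy ¬xy
    least (cons _ (cons _ _)) _ = s≤s (s≤s z≤n)

  CommonNeighbour : V → V → Set
  CommonNeighbour x y = ∃ λ a → Adj G x a × Adj G a y

  -- The hypotheses put `y` at distance at least three from `x`, so the given walk with three edges
  -- is shortest.
  threePath⇒onGeodesic : ∀ {x a b y} → y ≢ x → ¬ Adj G x y → ¬ CommonNeighbour x y →
    Adj G x a → Adj G a b → Adj G b y → b ≢ x → OnGeodesic G x y a × OnGeodesic G x y b
  threePath⇒onGeodesic {x} {a} {b} {y} y≢x ¬xy ¬xvy xa ab by b≢x =
    (walk , geo , there (here refl)) , (walk , geo , there (there (here refl)))
    where
    walk : Walk G x y
    walk = cons xa (cons ab (cons by nil))
    least : (q : Walk G x y) → IsPath q → 3 ≤ length q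
    least nil                           _ = contradiction refl y≢x
    least (cons xy nil)                 _ = contradiction xy ¬xy
    least (cons xv (cons vy nil))       _ = contradiction (_ , xv , vy) ¬xvy
    least (cons _ (cons _ (cons _ _)))  _ = s≤s (s≤s (s≤s z≤n))
    geo : IsGeodesic walk
    geo =
      ((adj⇒≢ xa ∷ ≢-sym b≢x ∷ ≢-sym y≢x ∷ []) ∷
        (adj⇒≢ ab ∷ (λ a≡y → ¬xy (subst (Adj G x) a≡y xa)) ∷ []) ∷ path₁ by) ,
      least

  -- An arbitrary path suffices: strong induction on the length shows that no path is shortest.
  path⇒¬¬start-onGeodesic : ∀ {x y} (p : Walk G x y) → IsPath p → ¬ ¬ OnGeodesic G x y x
  path⇒¬¬start-onGeodesic {x} {y} p path none = noPath (length p) p path refl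
    where
    x∈ : (q : Walk G x y) → x ∈ˡ vertices q
    x∈ nil        = here refl
    x∈ (cons _ _) = here refl
    noPath : ∀ k (q : Walk G x y) → IsPath q → length q ≢ k
    noPath = <-rec _ λ k ih q path-q q≡k → none
      (q , (path-q , λ r path-r → ℕ.≮⇒≥ λ r<q → ih (subst (_ <_) q≡k r<q) r path-r refl) , x∈ q)

-- Unique non-neighbours from omitted vertices

-- This says that the complement graph is a perfect matching. Both equivalences of the theorem pass
-- through this condition.
UniqueNonneighbour : ∀ {V} → SimpleGraph V → Set
UniqueNonneighbour G = ∀ u → ∃! _≡_ λ v → u ≢ v × ¬ Adj G u v

-- The vertex ω x plays the role of the vertex other than x omitted by an x-position set.
module _ {n} (G : SimpleGraph (Fin n)) (conn : Connected G)
  (nonneighbour : ∀ x → ∃ λ u → u ≢ x × ¬ Adj G x u)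
  (ω : Fin n → Fin n)
  (onGeodesic⇒ω : ∀ x {y z} → y ≢ x → z ≢ x → z ≢ y → OnGeodesic G x y z → ω x ≡ y ⊎ ω x ≡ z)
  where

  private
    DistanceAtMostTwo : Fin n → Fin n → Set
    DistanceAtMostTwo x y = y ≡ x ⊎ Adj G x y ⊎ CommonNeighbour G x y

    distanceAtMostTwo? : ∀ x y → Dec (DistanceAtMostTwo x y)
    distanceAtMostTwo? x y =
      y ≟ x ⊎-dec adj? G x y ⊎-dec Fin.any? λ a → adj? G x a ×-dec adj? G a y

    commonNeighbour⇒ω : ∀ x {y a} → y ≢ x → ¬ Adj G x y → Adj G x a → Adj G a y →
                        ω x ≡ y ⊎ ω x ≡ a
    commonNeighbour⇒ω x y≢x ¬xy xa ay =
      onGeodesic⇒ω x y≢x (≢-sym (adj⇒≢ G xa)) (adj⇒≢ G ay)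
        (commonNeighbour⇒onGeodesic G y≢x ¬xy xa ay)

    -- A geodesic x a v y would leave no choice for ω x, which must meet each pair among a, v, y.
    extend : ∀ {x v y} → DistanceAtMostTwo x v → Adj G v y → DistanceAtMostTwo x y
    extend (inj₁ refl) vy = inj₂ (inj₁ vy)
    extend (inj₂ (inj₁ xv)) vy = inj₂ (inj₂ (_ , xv , vy))
    extend {x} {v} {y} (inj₂ (inj₂ (a , xa , av))) vy
      with distanceAtMostTwo? x y | v ≟ x | adj? G x v
    ... | yes d | _ | _ = d
    ... | no _ | yes refl | _ = inj₂ (inj₁ vy)
    ... | no _ | no _ | yes xv = inj₂ (inj₂ (v , xv , vy))
    -- The pair `v`, `a` comes from the geodesic `x`, `a`, `v`; the pairs containing `y` come from
    -- its extension to `y`.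
    ... | no far | no v≢x | no ¬xv = ⊥-elim (impossible
        (commonNeighbour⇒ω x v≢x ¬xv xa av)
        (onGeodesic⇒ω x y≢x (≢-sym (adj⇒≢ G xa)) (≢-sym y≢a) (proj₁ geos))
        (onGeodesic⇒ω x y≢x v≢x (adj⇒≢ G vy) (proj₂ geos)))
      where
      y≢x : y ≢ x
      y≢x = far ∘ inj₁
      y≢a : y ≢ a
      y≢a refl = far (inj₂ (inj₁ xa))
      geos : OnGeodesic G x y a × OnGeodesic G x y v
      geos = threePath⇒onGeodesic G y≢x (far ∘ inj₂ ∘ inj₁) (far ∘ inj₂ ∘ inj₂) xa av vy v≢x
      impossible : ω x ≡ v ⊎ ω x ≡ a → ω x ≡ y ⊎ ω x ≡ a → ω x ≡ y ⊎ ω x ≡ v → ⊥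
      impossible (inj₁ p) (inj₁ q) _        = adj⇒≢ G vy (trans (sym p) q)
      impossible (inj₁ p) (inj₂ q) _        = adj⇒≢ G av (trans (sym q) p)
      impossible (inj₂ p) _        (inj₁ r) = y≢a (trans (sym r) p)
      impossible (inj₂ p) _        (inj₂ r) = adj⇒≢ G av (trans (sym p) r)

    walk⇒distanceAtMostTwo : ∀ {x v y} → DistanceAtMostTwo x v → Walk G v y → DistanceAtMostTwo x y
    walk⇒distanceAtMostTwo d nil         = d
    walk⇒distanceAtMostTwo d (cons vw p) = walk⇒distanceAtMostTwo (extend d vw) p

    -- Connectedness enters here: the distance bound is carried along a path from `x` to `y`.
    commonNeighbour : ∀ {x y} → y ≢ x → ¬ Adj G x y → CommonNeighbour G x y
    commonNeighbour {x} {y} y≢x ¬xy with walk⇒distanceAtMostTwo (inj₁ refl) (proj₁ (conn x y))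
    ... | inj₁ y≡x          = contradiction y≡x y≢x
    ... | inj₂ (inj₁ xy)    = contradiction xy ¬xy
    ... | inj₂ (inj₂ found) = found

    -- If `w` lay between `x` and `y`, it would be the only common neighbour of the two. A
    -- non-neighbour `u` of `w` refutes this, whether or not `u` is adjacent to `x`.
    ω-not-between : ∀ {x y w} → ω x ≡ w → y ≢ x → ¬ Adj G x y → Adj G x w → ¬ Adj G w y
    ω-not-between {x} {y} {w} refl y≢x ¬xy xw wy with nonneighbour w
    ... | u , u≢w , ¬wu with adj? G x u
    -- As `u` differs from `w`, a common neighbour of `x` and `u` must be `w`, which is not adjacent
    -- to `u`.
    ... | no ¬xu = ux-nonadjacent (commonNeighbour u≢x ¬xu)
      where
      u≢x : u ≢ x
      u≢x refl = ¬wu (adj-sym G xw)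
      ux-nonadjacent : CommonNeighbour G x u → ⊥
      ux-nonadjacent (a , xa , au) with commonNeighbour⇒ω x u≢x ¬xu xa au
      ... | inj₁ w≡u  = u≢w (sym w≡u)
      ... | inj₂ refl = ¬wu au
    -- Were `u` adjacent to `y`, it would be a second vertex between `x` and `y`. So `u` and `y` are
    -- non-adjacent and have a common neighbour `c`.
    ... | yes xu with commonNeighbour y≢u ¬uy
      where
      y≢u : y ≢ u
      y≢u refl = ¬xy xu
      ¬uy : ¬ Adj G u y
      ¬uy uy with commonNeighbour⇒ω x y≢x ¬xy xu uy
      ... | inj₁ w≡y = adj⇒≢ G wy w≡y
      ... | inj₂ w≡u = u≢w (sym w≡u)
    ... | c , uc , cy with adj? G x c
    -- Now `c` lies between `x` and `y`, which forces `c` to be `w`, although `c` is adjacent to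
    -- `u`.
    ...   | yes xc with commonNeighbour⇒ω x y≢x ¬xy xc cy
    ...     | inj₁ w≡y  = adj⇒≢ G wy w≡y
    ...     | inj₂ refl = ¬wu (adj-sym G uc)
    -- Now `u` lies between `x` and `c`, so `w` is `c` or `u`; the former is adjacent to `u` and the
    -- latter differs from `w`.
    ω-not-between {x} refl y≢x ¬xy xw wy | u , u≢w , ¬wu | yes xu | c , uc , cy | no ¬xc
      with commonNeighbour⇒ω x (λ { refl → ¬xy cy }) ¬xc xu uc
    ...     | inj₁ refl = ¬wu (adj-sym G uc)
    ...     | inj₂ w≡u  = u≢w (sym w≡u)

    nonneighbour≡ω : ∀ {x y} → y ≢ x → ¬ Adj G x y → ω x ≡ y
    nonneighbour≡ω {x} y≢x ¬xy with commonNeighbour y≢x ¬xy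
    ... | a , xa , ay with commonNeighbour⇒ω x y≢x ¬xy xa ay
    ...   | inj₁ ω≡y = ω≡y
    ...   | inj₂ ω≡a = contradiction ay (ω-not-between ω≡a y≢x ¬xy xa)

  uniqueNonneighbour : UniqueNonneighbour G
  uniqueNonneighbour x with nonneighbour x
  ... | u , u≢x , ¬xu = u , (≢-sym u≢x , ¬xu) , λ (x≢y , ¬xy) →
    trans (sym (nonneighbour≡ω u≢x ¬xu)) (nonneighbour≡ω (≢-sym x≢y) ¬xy)

-- Position sets consisting of neighbours

module _ {n} (G : SimpleGraph (Fin n)) where

  -- A geodesic to a neighbour contains only its two ends, and `x` is not its own neighbour. All
  -- lower bounds on position numbers rest on this.
  neighbours⇒isPositionSet : ∀ {x S} → (∀ {y} → y ∈ S → Adj G x y) → IsPositionSet G x S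
  neighbours⇒isPositionSet S⊆N y y∈S z z∈S z≢y on with adj⇒geodesic-ends G (S⊆N y∈S) on
  ... | inj₁ refl = adj-irr G refl (S⊆N z∈S)
  ... | inj₂ z≡y  = z≢y z≡y

  -- Used contrapositively: position number n - 2 forces a non-neighbour.
  universal⇒n≤1+positionNumber : ∀ {x} → (∀ {y} → y ≢ x → Adj G x y) → n ≤ suc (positionNumber G x)
  universal⇒n≤1+positionNumber {x} universal = ℕ.≤-trans (n≤1+∣⊤-x∣ x)
    (s≤s (∣S∣≤positionNumber G {S = ⊤ - x} (neighbours⇒isPositionSet (universal ∘ x∈p-y⇒x≢y))))

-- Position number n - 2 and unique non-neighbours

module _ {n} (4≤n : 4 ≤ n) (G : SimpleGraph (Fin n)) where

  module _ (conn : Connected G) (p≡ : ∀ x → 2 + positionNumber G x ≡ n) where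

    private
      nonneighbour : ∀ x → ∃ λ u → u ≢ x × ¬ Adj G x u
      nonneighbour x with Fin.any? (λ u → ¬? (u ≟ x) ×-dec ¬? (adj? G x u))
      ... | yes found = found
      ... | no none = contradiction
        (universal⇒n≤1+positionNumber G λ {y} y≢x →
          decidable-stable (adj? G x y) λ ¬xy → none (y , y≢x , ¬xy))
        (ℕ.<⇒≱ (ℕ.≤-reflexive (p≡ x)))

      module _ {x S} (pos : IsPositionSet G x S) (n≡ : 2 + ∣ S ∣ ≡ n) where

        -- By `4≤n` the set `S` has at least two elements, hence one other than `x`; some geodesic
        -- to it starts at `x`.
        centre∉ : x ∉ S
        centre∉ x∈S with ∣p∣<∣q∣⇒∃∈q∉p {p = ⁅ x ⁆} {S}
          (subst (_< ∣ S ∣) (sym (∣⁅x⁆∣≡1 x)) (s≤s⁻¹ (s≤s⁻¹ (subst (4 ≤_) (sym n≡) 4≤n))))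
        ... | y , y∈S , y∉⁅x⁆ = path⇒¬¬start-onGeodesic G (proj₁ (conn x y)) (proj₂ (conn x y))
          (pos y y∈S x x∈S λ { refl → y∉⁅x⁆ (x∈⁅x⁆ x) })

        -- Since `⊤ - x` is larger than `S`, a second vertex `w` is omitted. A third would give 3 +
        -- |S| ≤ n, against 2 + |S| = n.
        omitted : ∃ λ w → ∀ {v} → v ≢ x → v ≢ w → v ∈ S
        omitted with ∣p∣<∣q∣⇒∃∈q∉p {p = S} {⊤ - x}
          (s≤s⁻¹ (subst (_≤ suc ∣ ⊤ - x ∣) (sym n≡) (n≤1+∣⊤-x∣ x)))
        ... | w , w∈ , w∉S = w , λ {v} v≢x v≢w → decidable-stable (v ∈? S) λ v∉S →
          ℕ.<-irrefl n≡ (3+∣p∣≤n centre∉ w∉S v∉S (x∈p-y⇒x≢y w∈) v≢x v≢w)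

      -- This supplies `ω`: vertices other than `x` and `w` all belong to a maximum position set, so
      -- two of them cannot share such a geodesic.
      geodesicMeets : ∀ x → ∃ λ w → ∀ {y z} → y ≢ x → z ≢ x → z ≢ y → OnGeodesic G x y z →
                      w ≡ y ⊎ w ≡ z
      geodesicMeets x with positionNumber-attained G x
      ... | S , pos , p≡∣S∣ with omitted pos (trans (cong (2 +_) (sym p≡∣S∣)) (p≡ x))
      ... | w , rest = w , meets
        where
        meets : ∀ {y z} → y ≢ x → z ≢ x → z ≢ y → OnGeodesic G x y z → w ≡ y ⊎ w ≡ z
        meets {y} {z} y≢x z≢x z≢y on with w ≟ y | w ≟ z
        ... | yes w≡y | _       = inj₁ w≡y
        ... | no _    | yes w≡z = inj₂ w≡z
        ... | no w≢y  | no w≢z  = contradiction on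
          (pos y (rest y≢x (≢-sym w≢y)) z (rest z≢x (≢-sym w≢z)) z≢y)

    positionNumber≡n-2⇒uniqueNonneighbour : UniqueNonneighbour G
    positionNumber≡n-2⇒uniqueNonneighbour = uniqueNonneighbour G conn nonneighbour
      (proj₁ ∘ geodesicMeets) (λ x → proj₂ (geodesicMeets x))

  module _ (unique : UniqueNonneighbour G) (x : Fin n) where

    private
      w : Fin n
      w = proj₁ (unique x)

      x≢w : x ≢ w
      x≢w = proj₁ (proj₁ (proj₂ (unique x)))

      ¬xw : ¬ Adj G x w
      ¬xw = proj₂ (proj₁ (proj₂ (unique x)))

      x~ : ∀ {v} → v ≢ x → v ≢ w → Adj G x v
      x~ {v} v≢x v≢w = decidable-stable (adj? G x v) λ ¬xv →
        v≢w (sym (proj₂ (proj₂ (unique x)) (≢-sym v≢x , ¬xv)))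

      -- The relation is symmetric, so `x` is in turn the only non-neighbour of `w`.
      w~ : ∀ {v} → v ≢ x → v ≢ w → Adj G w v
      w~ {v} v≢x v≢w = decidable-stable (adj? G w v) λ ¬wv → v≢x
        (trans (sym (proj₂ (proj₂ (unique w)) (≢-sym v≢w , ¬wv)))
          (proj₂ (proj₂ (unique w)) (≢-sym x≢w , ¬xw ∘ adj-sym G)))

      -- Here `4≤n` is spent. Both vertices are needed to bound a position set that contains `x`.
      twoMore : ∃₂ λ a b → (a ≢ x × a ≢ w) × (b ≢ x × b ≢ w) × b ≢ a
      twoMore with ∣p∣<∣q∣⇒∃∈q∉p {p = Subset.⊥} {⊤ - x - w} (subst (_< ∣ ⊤ - x - w ∣)
        (sym (∣⊥∣≡0 n)) (ℕ.≤-trans (s≤s z≤n)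
          (s≤s⁻¹ (s≤s⁻¹ (ℕ.≤-trans 4≤n (n≤2+∣⊤-x-y∣ x w))))))
      ... | a , a∈ , _ with ∣p∣<∣q∣⇒∃∈q∉p {p = Subset.⊥} {⊤ - x - w - a} (subst
        (_< ∣ ⊤ - x - w - a ∣) (sym (∣⊥∣≡0 n))
          (s≤s⁻¹ (s≤s⁻¹ (s≤s⁻¹ (ℕ.≤-trans 4≤n (n≤3+∣⊤-x-y-z∣ x w a))))))
      ... | b , b∈ , _ = a , b , split a∈ , split (p─q⊆p _ _ b∈) , x∈p-y⇒x≢y b∈
        where
        split : ∀ {v} → v ∈ ⊤ - x - w → v ≢ x × v ≢ w
        split v∈ = x∈p-y⇒x≢y (p─q⊆p _ _ v∈) , x∈p-y⇒x≢y v∈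

      -- Two omitted vertices are found in each case: `x` and `w`; or, if only `w` is in `S`, then
      -- `x` and the common neighbour `a` of `x` and `w`; or, if `x` is in `S`, its neighbours `a`
      -- and `b`, since `x` starts the geodesic to each.
      n-2-bound : ∀ {S} → IsPositionSet G x S → 2 + ∣ S ∣ ≤ n
      n-2-bound {S} pos with twoMore | x ∈? S | w ∈? S
      ... | _ | no x∉S | no w∉S = 2+∣p∣≤n x∉S w∉S (≢-sym x≢w)
      ... | a , _ , (a≢x , a≢w) , _ | no x∉S | yes w∈S = 2+∣p∣≤n x∉S a∉S a≢x
        where
        a∉S : a ∉ S
        a∉S a∈S = pos w w∈S a a∈S a≢w (commonNeighbour⇒onGeodesic G (≢-sym x≢w) ¬xw
          (x~ a≢x a≢w) (adj-sym G (w~ a≢x a≢w)))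
      ... | a , b , (a≢x , a≢w) , (b≢x , b≢w) , b≢a | yes x∈S | _ =
        2+∣p∣≤n (neighbour∉S a≢x a≢w) (neighbour∉S b≢x b≢w) b≢a
        where
        neighbour∉S : ∀ {v} → v ≢ x → v ≢ w → v ∉ S
        neighbour∉S v≢x v≢w v∈S = pos _ v∈S x x∈S (≢-sym v≢x) (adj⇒start-onGeodesic G (x~ v≢x v≢w))

    uniqueNonneighbour⇒positionNumber≡n-2 : 2 + positionNumber G x ≡ n
    uniqueNonneighbour⇒positionNumber≡n-2 with positionNumber-attained G x
    ... | S , pos , p≡∣S∣ = ℕ.≤-antisym
      (subst (λ k → 2 + k ≤ n) (sym p≡∣S∣) (n-2-bound pos))
      (ℕ.≤-trans (n≤2+∣⊤-x-y∣ x w) (s≤s (s≤s (∣S∣≤positionNumber G {S = ⊤ - x - w}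
        (neighbours⇒isPositionSet G λ y∈ → x~ (x∈p-y⇒x≢y (p─q⊆p _ _ y∈)) (x∈p-y⇒x≢y y∈))))))

-- Cocktail party graphs

≅-sym : ∀ {V W} {G : SimpleGraph V} {H : SimpleGraph W} → G ≅ H → H ≅ G
≅-sym {G = G} {H} iso = record
  { vertices↔ = Symmetry.↔-sym vertices↔
  ; adj⇔ = λ u v → mk⇔
      (λ uv → Equivalence.from (adj⇔ _ _) (subst₂ (Adj H) (sym (to∘from u)) (sym (to∘from v)) uv))
      (λ uv → subst₂ (Adj H) (to∘from u) (to∘from v) (Equivalence.to (adj⇔ _ _) uv))
  }
  where
  open _≅_ iso
  to∘from = Inverse.strictlyInverseˡ vertices↔

≅-uniqueNonneighbour : ∀ {V W} {G : SimpleGraph V} {H : SimpleGraph W} → G ≅ H →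
                       UniqueNonneighbour H → UniqueNonneighbour G
≅-uniqueNonneighbour {G = G} {H} iso unique u with unique (Inverse.to (_≅_.vertices↔ iso) u)
... | w , (u≢w , ¬uw) , only =
  from w ,
  ((λ { refl → u≢w (to∘from w) }) ,
   λ uw → ¬uw (subst (Adj H (to u)) (to∘from w) (Equivalence.to (adj⇔ _ _) uw))) ,
  λ {v} (u≢v , ¬uv) → trans
    (cong from (only
      ((λ eq → u≢v (trans (sym (from∘to u)) (trans (cong from eq) (from∘to v)))) ,
       ¬uv ∘ Equivalence.from (adj⇔ _ _))))
    (from∘to v)
  where
  open _≅_ iso
  open Inverse vertices↔ using (to; from)
    renaming (strictlyInverseˡ to to∘from; strictlyInverseʳ to from∘to)

K₂,…,₂-uniqueNonneighbour : ∀ k → UniqueNonneighbour (K₂,…,₂ k)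
K₂,…,₂-uniqueNonneighbour k (i , b) =
  (i , opposite b) , ((λ eq → b≢opposite b (cong proj₂ eq)) , λ i≢i → i≢i refl) , only b
  where
  b≢opposite : ∀ (b : Fin 2) → b ≢ opposite b
  b≢opposite zero       ()
  b≢opposite (suc zero) ()
  only : ∀ b {v} → (i , b) ≢ v × ¬ i ≢ proj₁ v → (i , opposite b) ≡ v
  only b {j , c} (ib≢jc , ¬i≢j) with decidable-stable (i ≟ j) ¬i≢j
  only zero       {j , zero}     (ib≢jc , _) | refl = contradiction refl ib≢jc
  only zero       {j , suc zero} (ib≢jc , _) | refl = refl
  only (suc zero) {j , zero}     (ib≢jc , _) | refl = refl
  only (suc zero) {j , suc zero} (ib≢jc , _) | refl = contradiction refl ib≢jc

-- The non-neighbour of a vertex is its partner in `M`.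
perfectMatching-uniqueNonneighbour : ∀ {m} {M : SimpleGraph (Fin m)} →
  IsPerfectMatching (complete m) M → UniqueNonneighbour (complete m ∖ M)
perfectMatching-uniqueNonneighbour {M = M} (M⊆K , matched) u with matched u
... | w , uw , only = w , (M⊆K uw , λ (_ , ¬uw) → ¬uw uw) , λ (u≢v , ¬uv) →
  only (decidable-stable (adj? M u _) λ ¬Muv → ¬uv (u≢v , ¬Muv))

-- Fixed-point-free involutions

lookup-injective : ∀ {A : Set} {xs : List A} → Unique xs →
                   ∀ {i j} → lookup xs i ≡ lookup xs j → i ≡ j
lookup-injective (_ ∷ _)  {zero}  {zero}  _  = refl
lookup-injective {xs = _ ∷ xs} (x∉ ∷ _) {zero}  {suc j} eq =
  contradiction eq (All.lookup x∉ (∈-lookup {xs = xs} j))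
lookup-injective {xs = _ ∷ xs} (x∉ ∷ _) {suc i} {zero}  eq =
  contradiction (sym eq) (All.lookup x∉ (∈-lookup {xs = xs} i))
lookup-injective (_ ∷ u)  {suc i} {suc j} eq = cong suc (lookup-injective u eq)

-- The orbits of f are indexed by their smaller elements.
module _ {n} (f : Fin n → Fin n) (f-involutive : ∀ u → f (f u) ≡ u) (f-moves : ∀ u → f u ≢ u) where

  private
    minima : List (Fin n)
    minima = filter (λ u → u <ᶠ? f u) (allFin n)

    pair : Fin (List.length minima) × Fin 2 → Fin n
    pair (i , zero)     = lookup minima i
    pair (i , suc zero) = f (lookup minima i)

    minimal : ∀ i → lookup minima i <ᶠ f (lookup minima i)
    minimal i = proj₂ (∈-filter⁻ (λ u → u <ᶠ? f u) {xs = allFin n} (∈-lookup {xs = minima} i))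

    lookup-minima-injective : ∀ {i j} → lookup minima i ≡ lookup minima j → i ≡ j
    lookup-minima-injective =
      lookup-injective (Unique.filter⁺ (λ u → u <ᶠ? f u) (Unique.allFin⁺ n))

    -- Otherwise `f` would swap the two minima, and each would be smaller than the other.
    minimum≢f[minimum] : ∀ {i j} → lookup minima i ≢ f (lookup minima j)
    minimum≢f[minimum] {i} {j} eq = Fin.<-asym
      (subst (lookup minima i <ᶠ_) (trans (cong f eq) (f-involutive _)) (minimal i))
      (subst (lookup minima j <ᶠ_) (sym eq) (minimal j))

    pair-injective : ∀ {p q} → pair p ≡ pair q → p ≡ q
    pair-injective {_ , zero}     {_ , zero}     eq = cong (_, zero) (lookup-minima-injective eq)
    pair-injective {_ , zero}     {_ , suc zero} eq = contradiction eq minimum≢f[minimum]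
    pair-injective {_ , suc zero} {_ , zero}     eq = contradiction (sym eq) minimum≢f[minimum]
    pair-injective {_ , suc zero} {_ , suc zero} eq = cong (_, suc zero)
      (lookup-minima-injective (trans (sym (f-involutive _)) (trans (cong f eq) (f-involutive _))))

    index : ∀ {u} → u <ᶠ f u → ∃ λ i → lookup minima i ≡ u
    index {u} u<fu = _ , sym (lookup-index (∈-filter⁺ (λ u → u <ᶠ? f u) (∈-allFin u) u<fu))

    pair-surjective : ∀ u → ∃ λ p → pair p ≡ u
    pair-surjective u with Fin.<-cmp u (f u)
    ... | tri< u<fu _ _ = let i , eq = index u<fu in (i , zero) , eq
    ... | tri≈ _ u≡fu _ = contradiction (sym u≡fu) (f-moves u)
    -- Here `f u` is the listed minimum, and `u` is its image.
    ... | tri> _ _ fu<u =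
      let i , eq = index (subst (f u <ᶠ_) (sym (f-involutive u)) fu<u)
      in (i , suc zero) , trans (cong f eq) (f-involutive u)

  -- Normal form of a fixed-point-free involution: it is conjugate to the swap of second
  -- coordinates, with `k` the number of orbits.
  involution-pairing : ∃ λ k → ∃ λ (π : (Fin k × Fin 2) ↔ Fin n) →
    ∀ i b → f (Inverse.to π (i , b)) ≡ Inverse.to π (i , opposite b)
  involution-pairing = _ ,
    ⤖⇒↔ (mk⤖ {to = pair} (pair-injective , λ u → let p , eq = pair-surjective u in
      p , λ { refl → eq })) ,
    λ { i zero → refl ; i (suc zero) → f-involutive _ }

-- Identifying graphs with unique non-neighbours

module _ {n} {G : SimpleGraph (Fin n)} (unique : UniqueNonneighbour G) where

  private
    f : Fin n → Fin n
    f = proj₁ ∘ unique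

    f-moves : ∀ u → f u ≢ u
    f-moves u = ≢-sym (proj₁ (proj₁ (proj₂ (unique u))))

    ¬adj-f : ∀ u → ¬ Adj G u (f u)
    ¬adj-f u = proj₂ (proj₁ (proj₂ (unique u)))

    f-unique : ∀ {u v} → u ≢ v → ¬ Adj G u v → f u ≡ v
    f-unique u≢v ¬uv = proj₂ (proj₂ (unique _)) (u≢v , ¬uv)

    f-involutive : ∀ u → f (f u) ≡ u
    f-involutive u = f-unique (f-moves u) (¬adj-f u ∘ adj-sym G)

  uniqueNonneighbour⇒≅K₂,…,₂ : ∃ λ k → G ≅ K₂,…,₂ k
  uniqueNonneighbour⇒≅K₂,…,₂ with involution-pairing f f-involutive f-moves
  -- The orbits of `f` become the partite sets.
  ... | k , π , f-swaps = k , ≅-sym {G = K₂,…,₂ k} {H = G} (record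
    { vertices↔ = π
    ; adj⇔ = λ (i , b) (j , c) → mk⇔ (to~ i b j c) λ adj → λ { refl → to≁ i b c adj }
    })
    where
    to = Inverse.to π
    to-injective : ∀ {p q} → to p ≡ to q → p ≡ q
    to-injective {p} {q} eq = trans (sym (Inverse.strictlyInverseʳ π p))
      (trans (cong (Inverse.from π) eq) (Inverse.strictlyInverseʳ π q))
    to~ : ∀ i b j c → i ≢ j → Adj G (to (i , b)) (to (j , c))
    -- Non-adjacent distinct vertices are swapped by `f`, hence lie in the same orbit.
    to~ i b j c i≢j = decidable-stable (adj? G _ _) λ ¬adj → i≢j (cong proj₁ (to-injective
      (trans (sym (f-swaps i b)) (f-unique (i≢j ∘ cong proj₁ ∘ to-injective) ¬adj))))
    ¬adj-opposite : ∀ i b → ¬ Adj G (to (i , b)) (to (i , opposite b))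
    ¬adj-opposite i b = subst (¬_ ∘ Adj G _) (f-swaps i b) (¬adj-f _)
    to≁ : ∀ i b c → ¬ Adj G (to (i , b)) (to (i , c))
    to≁ i zero       zero       = adj-irr G refl
    to≁ i zero       (suc zero) = ¬adj-opposite i zero
    to≁ i (suc zero) zero       = ¬adj-opposite i (suc zero)
    to≁ i (suc zero) (suc zero) = adj-irr G refl

  uniqueNonneighbour⇒evenCliqueMinusPerfectMatching : IsEvenCliqueMinusPerfectMatching G
  uniqueNonneighbour⇒evenCliqueMinusPerfectMatching with uniqueNonneighbour⇒≅K₂,…,₂
  -- The deleted matching is the complement of `G`, and `unique` is literally its perfectness.
  -- Evenness follows by counting the vertices of `K₂,…,₂ k`.
  ... | k , iso = n , complete n ∖ G ,
    divides k (↔⇒≡ (Symmetry.↔-sym (Fin.*↔× {k} {2}) ↔-∘ _≅_.vertices↔ iso)) ,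
    (proj₁ , unique) ,
    record
      { vertices↔ = Identity.↔-id _
      ; adj⇔ = λ u v → mk⇔
          (λ uv → adj⇒≢ G uv , λ (_ , ¬uv) → ¬uv uv)
          (λ (u≢v , ¬¬uv) → decidable-stable (adj? G u v) λ ¬uv → ¬¬uv (u≢v , ¬uv))
      }

theorem4p4 : ∀ (n : ℕ) → n ≥ 4 → (G : SimpleGraph (Fin n)) → Connected G →
    ((vp⁻ G ≡ n ∸ 2 × vp G ≡ n ∸ 2) ⇔ IsEvenCliqueMinusPerfectMatching G)
    × ((vp⁻ G ≡ n ∸ 2 × vp G ≡ n ∸ 2) ⇔ (∃[ k ] G ≅ K₂,…,₂ k))
theorem4p4 (suc (suc m)) n≥4@(s≤s (s≤s _)) G conn =
  mk⇔ (uniqueNonneighbour⇒evenCliqueMinusPerfectMatching ∘ vp⇒unique)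
      (λ (_ , M , _ , matching , iso) → unique⇒vp
        (≅-uniqueNonneighbour iso (perfectMatching-uniqueNonneighbour {M = M} matching))) ,
  mk⇔ (uniqueNonneighbour⇒≅K₂,…,₂ ∘ vp⇒unique)
      (λ (k , iso) → unique⇒vp
        (≅-uniqueNonneighbour {H = K₂,…,₂ k} iso (K₂,…,₂-uniqueNonneighbour k)))
  where
  const⇔vp : (∀ x → positionNumber G x ≡ m) ⇔ (vp⁻ G ≡ m × vp G ≡ m)
  -- With `n` matched as `suc (suc m)`, `n ∸ 2` computes to `m` and `zero` is a vertex.
  const⇔vp = positionNumber-const⇔vp G zero (ℕ.m≤n+m m 2)
  vp⇒unique : vp⁻ G ≡ m × vp G ≡ m → UniqueNonneighbour G
  vp⇒unique vp≡ = positionNumber≡n-2⇒uniqueNonneighbour n≥4 G conn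
    (cong (2 +_) ∘ Equivalence.from const⇔vp vp≡)
  unique⇒vp : UniqueNonneighbour G → vp⁻ G ≡ m × vp G ≡ m
  unique⇒vp unique = Equivalence.to const⇔vp λ x →
    ℕ.suc-injective (ℕ.suc-injective (uniqueNonneighbour⇒positionNumber≡n-2 n≥4 G unique x))
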